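{- For each integer $a\ge 0$, there exists an integer $t_2=t_2(a)$ such that for every integer $t\ge t_2$, there exists a $K_t$-minor-free graph that is not $\{1\star (t-5a-9),\,3\star (2a+3)\}$-choosable.
   Context: All graphs are finite and simple. A graph is $K_t$-minor-free if $K_t$ cannot be obtained from a subgraph of it by contracting edges. A list assignment $L$ of a graph $G$ assigns to each vertex $v$ a set $L(v)$ of colours; an $L$-colouring is a proper colouring $f$ with $f(v)\in L(v)$ for all $v$. For a multiset $\lambda=\{k_1,\dots,k_q\}$ of positive integers, a $\lambda$-list assignment of $G$ is a list assignment $L$ such that the colour set $\bigcup_{v\in V(G)}L(v)$ can be partitioned into $q$ sets $C_1,\dots,C_q$ with $|L(v)\cap C_i|\ge k_i$ for every $i$ and every vertex $v$. $G$ is $\lambda$-choosable if $G$ is $L$-colourable for every $\lambda$-list assignment $L$. The notation $b\star m$ inside a multiset means $m$ copies of $b$; so $\{1\star(t-5a-9),3\star(2a+3)\}$ consists of $t-5a-9$ ones and $2a+3$ threes. -}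

module Defs where

open import Data.Fin using (Fin)
open import Data.Fin.Properties using (_≟_)
open import Data.List using (List; length; lookup)
open import Data.Nat using (ℕ)
open import Data.Product using (Σ-syntax; ∃-syntax; _×_)
open import Data.Sum using (_⊎_)
open import Function using (_∘_)
open import Function.Bundles using (_⇔_; _↣_; Injection)
open import Function.Definitions using (Surjective)
open import Level using (0ℓ)
open import Relation.Binary using (Rel; Symmetric; Decidable)
open import Relation.Binary.Construct.Closure.ReflexiveTransitive using (Star)
open import Relation.Binary.PropositionalEquality using (_≡_; _≢_; refl; sym)
open import Relation.Nullary using (¬_)
open import Relation.Nullary.Decidable using (¬?)
open import Relation.Unary using (Pred; _∈_; _∩_; _≐_; ⋃)

record Graph : Set₁ where
  field
    order  : ℕ
    Adj    : Rel (Fin order) 0ℓ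
    adj?   : Decidable Adj
    symm   : Symmetric Adj
    irrefl : ∀ {v} → ¬ Adj v v

  Vertex : Set
  Vertex = Fin order

open Graph public using (Vertex)

K : ℕ → Graph
K t = record
  { order  = t
  ; Adj    = _≢_
  ; adj?   = λ u v → ¬? (u ≟ v)
  ; symm   = λ u≢v → u≢v ∘ sym
  ; irrefl = λ v≢v → v≢v refl
  }

-- H is isomorphic to a (not necessarily induced) subgraph of G.
record _IsSubgraphOf_ (H G : Graph) : Set where
  field
    embed    : Vertex H ↣ Vertex G
    preserve : ∀ {x y} → Graph.Adj H x y →
               Graph.Adj G (Injection.to embed x) (Injection.to embed y)

-- H is isomorphic to the simple graph G / uv for some edge uv of G;
-- π is the quotient map identifying u with v and nothing else.
record _ContractsEdgeTo_ (G H : Graph) : Set where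
  field
    u v        : Vertex G
    edge       : Graph.Adj G u v
    π          : Vertex G → Vertex H
    surjective : Surjective _≡_ _≡_ π
    fibres     : ∀ x y → π x ≡ π y ⇔
                 (x ≡ y ⊎ (x ≡ u × y ≡ v) ⊎ (x ≡ v × y ≡ u))
    adjacency  : ∀ a b → Graph.Adj H a b ⇔
                 (a ≢ b × ∃[ x ] ∃[ y ] (π x ≡ a × π y ≡ b × Graph.Adj G x y))

_IsMinorOf_ : Graph → Graph → Set₁
M IsMinorOf G = Σ[ H ∈ Graph ] (H IsSubgraphOf G × Star _ContractsEdgeTo_ H M)

_MinorFree_ : Graph → Graph → Set₁
M MinorFree G = ¬ (M IsMinorOf G)

ListAssignment : Graph → Set → Set₁
ListAssignment G Colour = Vertex G → Pred Colour 0ℓ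

record Colouring (G : Graph) {Colour : Set} (L : ListAssignment G Colour) : Set where
  field
    colour : Vertex G → Colour
    proper : ∀ {x y} → Graph.Adj G x y → colour x ≢ colour y
    inList : ∀ x → colour x ∈ L x

-- |S| ≥ k, for a possibly infinite set S.
HasAtLeast : {A : Set} → ℕ → Pred A 0ℓ → Set
HasAtLeast {A} k S = Σ[ e ∈ (Fin k ↣ A) ] (∀ i → Injection.to e i ∈ S)

-- The multiset {k₁, …, k_q} is given as a list; the order is immaterial
-- because the parts may be reindexed.
record IsListAssignmentOfType (ks : List ℕ) (G : Graph) {Colour : Set}
                              (L : ListAssignment G Colour) : Set₁ where
  field
    part     : Fin (length ks) → Pred Colour 0ℓ
    covers   : ⋃ (Vertex G) L ≐ ⋃ (Fin (length ks)) part
    disjoint : ∀ {i j c} → c ∈ part i → c ∈ part j → i ≡ j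
    large    : ∀ i x → HasAtLeast (lookup ks i) (L x ∩ part i)

_Choosable_ : List ℕ → Graph → Set₁
ks Choosable G = ∀ {Colour : Set} (L : ListAssignment G Colour) →
                 IsListAssignmentOfType ks G L → Colouring G L

{-# OPTIONS --safe #-}
module Submission where

-- Put p = a + 2 and s = t − 1 − p.  The hub is a clique Q on t − 1 vertices
-- with the same t + a colours in every list, so a colouring of Q misses only
-- a + 1 colours and uses all three colours of at least p of the 2a + 3 parts of
-- size 3.  For every choice of p parts and of a window of 3p vertices of Q
-- supposed to carry their colours, attach to the window its own clique B on s
-- vertices.  Each b ∈ B has a type f : {1..p} → {1,2,3}; in the j-th chosen
-- part it trades the colour f(j) for a common fourth colour, which allows the
-- edge from b to the window vertex of colour (j, f(j)) to be left out.  The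
-- copy for the actual colouring of Q then needs s + 3p = t + 2a + 3 colours,
-- one more than are available.
--
-- In a K_t-model some branch set avoids Q and so lies in a single copy of B;
-- all branch sets then meet that copy or its window.  If each of them contains a
-- vertex of B or two window vertices of one part, then t ≤ s + p.  Otherwise one
-- contains no vertex of B and is a partial transversal of the window, so it has
-- no neighbour of some type f; then all branch sets contain a window vertex or
-- a vertex of B of another type, and t ≤ 3p + s − 2p if each type occurs
-- 2p times in B.  Both contradict t = s + p + 1.

open import Data.Empty using (⊥-elim)
open import Data.Fin using (Fin; zero; suc; _↑ˡ_; combine; remQuot; splitAt; finToFun; funToFin; fromℕ; inject₁; punchIn)
open import Data.Fin.Properties using (_≟_; any?; all?; ¬∀⟶∃¬; injective⇒≤; +↔⊎; *↔×; suc-injective; combine-injectiveʳ; ↑ˡ-injective; splitAt-↑ˡ; remQuot-combine; finToFun-funToFin; punchIn-injective; punchInᵢ≢i)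
open import Data.Fin.Relation.Unary.Top using (view; ‵fromℕ; ‵inject₁)
open import Data.List using (_++_; replicate; length; lookup)
open import Data.Nat using (ℕ; zero; suc; _+_; _*_; _∸_; _^_; _≤_; _<_; s≤s)
open import Data.Nat.Properties using (≤-reflexive; <⇒≱; m≤n⇒∃[o]m+o≡n; ∸-+-assoc; m+n∸m≡n; +-suc)
open import Data.Nat.Solver using (module +-*-Solver)
open import Data.Product using (Σ-syntax; ∃-syntax; _×_; _,_; proj₁; proj₂)
open import Data.Product.Properties using () renaming (≡-dec to ×-≡-dec)
open import Data.Sum using (_⊎_; inj₁; inj₂; [_,_]′)
open import Data.Sum.Function.Propositional using (_⊎-↔_)
open import Data.Sum.Properties using (inj₁-injective; inj₂-injective) renaming (≡-dec to ⊎-≡-dec)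
open import Data.Unit using (⊤; tt)
open import Function using (_∘_; id)
open import Function.Bundles using (_↔_; Inverse; Injection; Equivalence; mk↣)
open import Function.Construct.Composition using (_↔-∘_)
open import Function.Construct.Identity using (↔-id)
open import Function.Definitions using (Injective)
open import Level using (0ℓ)
open import Relation.Binary.Construct.Closure.ReflexiveTransitive using (Star; ε; _◅_)
open import Relation.Binary.PropositionalEquality using (_≡_; _≢_; refl; sym; trans; cong; subst)
open import Relation.Nullary using (¬_; Dec; yes; no)
open import Relation.Nullary.Decidable using (¬?; _×-dec_; _⊎-dec_; _→-dec_; toWitness; decidable-stable)
open import Relation.Unary using (Pred)
import Relation.Unary as U
open import Defs

-- Counting in finite sets.

-- A relation in place of a function lets witnesses stay existential; with disjoint sums for `A` and
-- `B`, each count below becomes a case analysis.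
pigeonhole : {A B : Set} {m n : ℕ} → Fin m ↔ A → Fin n ↔ B →
             (R : A → B → Set) → (∀ x → ∃[ y ] R x y) →
             (∀ {x x′ y} → R x y → R x′ y → x ≡ x′) → m ≤ n
pigeonhole {A} {B} {m} {n} F G R total unique = injective⇒≤ {f = f} f-injective
  where
  open Inverse
  y : Fin m → B
  y i = proj₁ (total (to F i))
  f : Fin m → Fin n
  f i = from G (y i)
  f-injective : Injective _≡_ _≡_ f
  f-injective {i} {j} fi≡fj = trans (sym (strictlyInverseʳ F i))
    (trans (cong (from F) to≡) (strictlyInverseʳ F j))
    where
    y≡ : y i ≡ y j
    y≡ = trans (sym (strictlyInverseˡ G (y i)))
         (trans (cong (to G) fi≡fj) (strictlyInverseˡ G (y j)))
    to≡ : to F i ≡ to F j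
    to≡ = unique (subst (R (to F i)) y≡ (proj₂ (total (to F i)))) (proj₂ (total (to F j)))

HasAtLeast-zero : {A : Set} (S : Pred A 0ℓ) → HasAtLeast 0 S
HasAtLeast-zero S = mk↣ {to = λ ()} (λ {}) , λ ()

HasAtLeast-shift : ∀ {k n} (S : Pred (Fin (suc n)) 0ℓ) → HasAtLeast k (S ∘ suc) → HasAtLeast k S
HasAtLeast-shift S (e , e∈S) =
  mk↣ {to = suc ∘ Injection.to e} (Injection.injective e ∘ suc-injective) , e∈S

HasAtLeast-cons : ∀ {k n} (S : Pred (Fin (suc n)) 0ℓ) → S zero → HasAtLeast k (S ∘ suc) → HasAtLeast (suc k) S
HasAtLeast-cons {k} {n} S z (e , e∈S) = mk↣ {to = f} f-injective , f∈S
  where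
  f : Fin (suc k) → Fin (suc n)
  f zero    = zero
  f (suc i) = suc (Injection.to e i)
  f-injective : Injective _≡_ _≡_ f
  f-injective {zero}  {zero}  _  = refl
  f-injective {suc i} {suc j} eq = cong suc (Injection.injective e (suc-injective eq))
  f∈S : ∀ i → S (f i)
  f∈S zero    = z
  f∈S (suc i) = e∈S i

-- If both alternatives failed, `n` would be at most `(x - 1) + (y - 1)`. In the induction the first
-- element lowers `x` or `y` by one.
dichotomy : ∀ n x y (P : Pred (Fin n) 0ℓ) → U.Decidable P → x + y ≤ suc n →
            HasAtLeast x P ⊎ HasAtLeast y (U.∁ P)
dichotomy n       zero          y       P P? le = inj₁ (HasAtLeast-zero P)
dichotomy n       (suc x)       zero    P P? le = inj₂ (HasAtLeast-zero (U.∁ P))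
dichotomy zero    (suc zero)    (suc y) P P? (s≤s ())
dichotomy zero    (suc (suc x)) (suc y) P P? (s≤s ())
dichotomy (suc n) (suc x)       (suc y) P P? (s≤s le) with P? zero
... | yes p with dichotomy n x (suc y) (P ∘ suc) (P? ∘ suc) le
...   | inj₁ h = inj₁ (HasAtLeast-cons P p h)
...   | inj₂ h = inj₂ (HasAtLeast-shift (U.∁ P) h)
dichotomy (suc n) (suc x)       (suc y) P P? (s≤s le) | no ¬p
  with dichotomy n (suc x) y (P ∘ suc) (P? ∘ suc) (subst (_≤ suc n) (+-suc x y) le)
...   | inj₁ h = inj₁ (HasAtLeast-shift P h)
...   | inj₂ h = inj₂ (HasAtLeast-cons (U.∁ P) ¬p h)

-- From contraction sequences to minor models.

-- Connectedness of the fibres is expressed by saying that a predicate which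
-- is preserved along the edges inside fibres is constant on each fibre.
record Model (M H : Graph) : Set₁ where
  field
    π          : Vertex H → Vertex M
    surjective : ∀ a → ∃[ x ] π x ≡ a
    connected  : (P : Pred (Vertex H) 0ℓ) →
                 (∀ {x y} → Graph.Adj H x y → π x ≡ π y → P x → P y) →
                 ∀ {x y} → π x ≡ π y → P x → P y
    adjacent   : ∀ {a b} → Graph.Adj M a b →
                 ∃[ x ] ∃[ y ] (π x ≡ a × π y ≡ b × Graph.Adj H x y)

contractions⇒model : ∀ {H M} → Star _ContractsEdgeTo_ H M → Model M H
contractions⇒model {H} ε = record
  { π          = id
  ; surjective = λ a → a , refl
  ; connected  = λ { P _ refl p → p }
  ; adjacent   = λ {a} {b} e → a , b , refl , refl , e
  }
contractions⇒model {H} {M} (_◅_ {j = H′} c cs) = record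
  { π          = N.π ∘ C.π
  ; surjective = surj
  ; connected  = conn
  ; adjacent   = adj
  }
  where
  module C = _ContractsEdgeTo_ c
  module N = Model (contractions⇒model cs)
  surj : ∀ a → ∃[ x ] N.π (C.π x) ≡ a
  surj a with N.surjective a
  ... | b , refl with C.surjective b
  ...   | x , πx≡ = x , cong N.π (πx≡ refl)
  adj : ∀ {a b} → Graph.Adj M a b →
        ∃[ x ] ∃[ y ] (N.π (C.π x) ≡ a × N.π (C.π y) ≡ b × Graph.Adj H x y)
  adj e with N.adjacent e
  ... | a′ , b′ , refl , refl , e′ with Equivalence.to (C.adjacency a′ b′) e′
  ...   | _ , x , y , refl , refl , e″ = x , y , refl , refl , e″
  conn : (P : Pred (Vertex H) 0ℓ) →
         (∀ {x y} → Graph.Adj H x y → N.π (C.π x) ≡ N.π (C.π y) → P x → P y) →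
         ∀ {x y} → N.π (C.π x) ≡ N.π (C.π y) → P x → P y
  conn P preserved {x} {y} eq p with N.connected P′ preserved′ eq (x , refl , p)
    where
    -- `P` is pushed forward as "holds somewhere in the fibre". A fibre is a single vertex or the
    -- two ends of the contracted edge, so `P` spreads from one point to all of it.
    P′ : Pred (Vertex H′) 0ℓ
    P′ b = ∃[ z ] (C.π z ≡ b × P z)
    sameFibre : ∀ {x y} → C.π x ≡ C.π y → P x → P y
    sameFibre {x} {y} πx≡πy px with Equivalence.to (C.fibres x y) πx≡πy
    ... | inj₁ refl = px
    ... | inj₂ (inj₁ (refl , refl)) = preserved C.edge (cong N.π πx≡πy) px
    ... | inj₂ (inj₂ (refl , refl)) = preserved (Graph.symm H C.edge) (cong N.π πx≡πy) px
    preserved′ : ∀ {a b} → Graph.Adj H′ a b → N.π a ≡ N.π b → P′ a → P′ b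
    preserved′ {a} {b} e πa≡πb (z , refl , pz) with Equivalence.to (C.adjacency a b) e
    ... | _ , x , y , πx≡a , refl , e′ =
      y , refl , preserved e′ (trans (cong N.π πx≡a) πa≡πb) (sameFibre (sym πx≡a) pz)
  ... | z , πz≡πy , pz with Equivalence.to (C.fibres z y) πz≡πy
  ...   | inj₁ refl = pz
  ...   | inj₂ (inj₁ (refl , refl)) = preserved C.edge (cong N.π πz≡πy) pz
  ...   | inj₂ (inj₂ (refl , refl)) = preserved (Graph.symm H C.edge) (cong N.π πz≡πy) pz

-- The graph and the exclusion of `K t`-models.

pairs-meet? : Dec ((k k′ l l′ : Fin 3) → k ≢ k′ → l ≢ l′ → k ≡ l ⊎ k ≡ l′ ⊎ k′ ≡ l ⊎ k′ ≡ l′)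
pairs-meet? = all? λ k → all? λ k′ → all? λ l → all? λ l′ →
  ¬? (k ≟ k′) →-dec ¬? (l ≟ l′) →-dec (k ≟ l ⊎-dec k ≟ l′ ⊎-dec k′ ≟ l ⊎-dec k′ ≟ l′)

pairs-meet : (k k′ l l′ : Fin 3) → k ≢ k′ → l ≢ l′ → k ≡ l ⊎ k ≡ l′ ⊎ k′ ≡ l ⊎ k′ ≡ l′
pairs-meet = toWitness {a? = pairs-meet?} tt

-- The hub Q is a clique on n vertices.  The I-th copy of the s-clique B is
-- attached to Q through its window, the vertices w I j k: the vertex b of
-- the copy misses exactly the window vertices w I j (τ b j).
module Construction (n s p copies : ℕ)
  (τ : Fin s → Fin p → Fin 3)
  (w : Fin copies → Fin p → Fin 3 → Fin n) where

  V : Set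
  V = Fin n ⊎ (Fin copies × Fin s)

  _≟V_ : (u v : V) → Dec (u ≡ v)
  _≟V_ = ⊎-≡-dec _≟_ (×-≡-dec _≟_ _≟_)

  V↔ : Fin (n + copies * s) ↔ V
  V↔ = (↔-id _ ⊎-↔ *↔×) ↔-∘ +↔⊎

  open Inverse V↔ public using () renaming (to to decode; from to encode; strictlyInverseˡ to decode-encode)

  decode-injective : Injective _≡_ _≡_ decode
  decode-injective {x} {y} eq = trans (sym (Inverse.strictlyInverseʳ V↔ x))
    (trans (cong encode eq) (Inverse.strictlyInverseʳ V↔ y))

  -- A window may repeat a hub vertex; then one position `(j , k)` of `q` with `τ b j ≢ k` is enough
  -- for the edge.
  Sees : Fin copies → Fin s → Fin n → Set
  Sees I b q = ∃[ j ] ∃[ k ] (w I j k ≡ q × τ b j ≢ k)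

  E : V → V → Set
  E (inj₁ q)       (inj₁ q′)        = q ≢ q′
  E (inj₁ q)       (inj₂ (I , b))   = Sees I b q
  E (inj₂ (I , b)) (inj₁ q)         = Sees I b q
  E (inj₂ (I , b)) (inj₂ (I′ , b′)) = I ≡ I′ × b ≢ b′

  sees? : ∀ I b q → Dec (Sees I b q)
  sees? I b q = any? λ j → any? λ k → w I j k ≟ q ×-dec ¬? (τ b j ≟ k)

  E? : ∀ u v → Dec (E u v)
  E? (inj₁ q)       (inj₁ q′)        = ¬? (q ≟ q′)
  E? (inj₁ q)       (inj₂ (I , b))   = sees? I b q
  E? (inj₂ (I , b)) (inj₁ q)         = sees? I b q
  E? (inj₂ (I , b)) (inj₂ (I′ , b′)) = I ≟ I′ ×-dec ¬? (b ≟ b′)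

  E-sym : ∀ u v → E u v → E v u
  E-sym (inj₁ q)       (inj₁ q′)        e         = e ∘ sym
  E-sym (inj₁ q)       (inj₂ (I , b))   e         = e
  E-sym (inj₂ (I , b)) (inj₁ q)         e         = e
  E-sym (inj₂ (I , b)) (inj₂ (I′ , b′)) (eq , ne) = sym eq , ne ∘ sym

  E-irrefl : ∀ v → ¬ E v v
  E-irrefl (inj₁ q)       e        = e refl
  E-irrefl (inj₂ (I , b)) (_ , ne) = ne refl

  graph : Graph
  graph = record
    { order  = n + copies * s
    ; Adj    = λ x y → E (decode x) (decode y)
    ; adj?   = λ x y → E? (decode x) (decode y)
    ; symm   = λ {x} {y} → E-sym (decode x) (decode y)
    ; irrefl = λ {x} → E-irrefl (decode x)
    }

  module _ {t : ℕ} {H : Graph} (H⊆G : H IsSubgraphOf graph) (model : Model (K t) H) where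
    open _IsSubgraphOf_ H⊆G
    open Model model

    ρ : Vertex H → V
    ρ x = decode (Injection.to embed x)

    Hits : Fin t → V → Set
    Hits c v = ∃[ x ] (π x ≡ c × ρ x ≡ v)

    hits? : ∀ c v → Dec (Hits c v)
    hits? c v = any? λ x → π x ≟ c ×-dec ρ x ≟V v

    hits-unique : ∀ {c c′ v} → Hits c v → Hits c′ v → c ≡ c′
    hits-unique (x , refl , refl) (x′ , refl , eq) =
      cong π (Injection.injective embed (decode-injective (sym eq)))

    HitsCopy HitsWindow : Fin copies → Fin t → Set
    HitsCopy   I c = ∃[ b ] Hits c (inj₂ (I , b))
    HitsWindow I c = ∃[ j ] ∃[ k ] Hits c (inj₁ (w I j k))

    InCopy : Fin copies → Vertex H → Set
    InCopy I x = ∃[ b ] ρ x ≡ inj₂ (I , b)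

    copy-neighbour : ∀ {I x y b} → Graph.Adj H x y → ρ x ≡ inj₂ (I , b) →
                     InCopy I y ⊎ (∃[ j ] ∃[ k ] (ρ y ≡ inj₁ (w I j k) × τ b j ≢ k))
    copy-neighbour {I} {x} {y} {b} e eq = split (ρ y) refl (subst (λ v → E v (ρ y)) eq (preserve e))
      where
      split : ∀ v → ρ y ≡ v → E (inj₂ (I , b)) v →
              InCopy I y ⊎ (∃[ j ] ∃[ k ] (ρ y ≡ inj₁ (w I j k) × τ b j ≢ k))
      split (inj₁ _)        eq′ (j , k , refl , ne) = inj₂ (j , k , eq′ , ne)
      split (inj₂ (_ , b′)) eq′ (refl , _)          = inj₁ (b′ , eq′)

    -- The only way out of a copy leads through its window, and branch sets are connected.
    confined : ∀ {I c} → HitsCopy I c → ¬ HitsWindow I c → ∀ {y} → π y ≡ c → InCopy I y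
    confined {I} {c} (b , x , πx≡c , ρx≡) ¬window {y} πy≡c =
      -- The premise `π z ≡ c` sits inside the predicate because `connected` demands preservation
      -- along the edges of every fibre.
      connected (λ z → π z ≡ c → InCopy I z) preserved (trans πx≡c (sym πy≡c)) (λ _ → b , ρx≡) πy≡c
      where
      preserved : ∀ {z z′} → Graph.Adj H z z′ → π z ≡ π z′ →
                  (π z ≡ c → InCopy I z) → π z′ ≡ c → InCopy I z′
      preserved {z} {z′} e πz≡πz′ pz πz′≡c with copy-neighbour e (proj₂ (pz (trans πz≡πz′ πz′≡c)))
      ... | inj₁ inCopy            = inCopy
      ... | inj₂ (j , k , eq , _) = ⊥-elim (¬window (j , k , z′ , πz′≡c , eq))

    -- The hub has fewer than `t` vertices and branch sets are disjoint, so one of them avoids the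
    -- hub altogether.
    confining : n < t → ∃[ I ] ∃[ c ] (HitsCopy I c × ¬ HitsWindow I c)
    confining n<t with all? (λ c → any? λ q → hits? c (inj₁ q))
    ... | yes hub = ⊥-elim (<⇒≱ n<t
      (pigeonhole (↔-id _) (↔-id _) (λ c q → Hits c (inj₁ q)) hub hits-unique))
    ... | no ¬hub with ¬∀⟶∃¬ t _ (λ c → any? λ q → hits? c (inj₁ q)) ¬hub
    ...   | c , ¬q with surjective c
    ...     | x , πx≡c with ρ x in eq
    ...       | inj₁ q       = ⊥-elim (¬q (q , x , πx≡c , eq))
    ...       | inj₂ (I , b) = I , c , (b , x , πx≡c , eq) , λ (j , k , h) → ¬q (w I j k , h)

    -- Every other branch set is adjacent to that of `c₀`, which is confined to the copy.
    meets : ∀ {I c₀} → HitsCopy I c₀ → ¬ HitsWindow I c₀ → ∀ c → HitsCopy I c ⊎ HitsWindow I c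
    meets {I} {c₀} copy ¬window c with c₀ ≟ c
    ... | yes refl = inj₁ copy
    ... | no c₀≢c with adjacent c₀≢c
    ...   | x , y , πx≡ , πy≡ , e with copy-neighbour e (proj₂ (confined copy ¬window πx≡))
    ...     | inj₁ (b , eq)         = inj₁ (b , y , πy≡ , eq)
    ...     | inj₂ (j , k , eq , _) = inj₂ (j , k , y , πy≡ , eq)

    HitsTwice : Fin copies → Fin t → Fin p → Set
    HitsTwice I c j = ∃[ k ] ∃[ k′ ] (k ≢ k′ × Hits c (inj₁ (w I j k)) × Hits c (inj₁ (w I j k′)))

    hitsTwice? : ∀ I c j → Dec (HitsTwice I c j)
    hitsTwice? I c j = any? λ k → any? λ k′ →
      ¬? (k ≟ k′) ×-dec hits? c (inj₁ (w I j k)) ×-dec hits? c (inj₁ (w I j k′))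

    -- Two pairs from a set of three share an element, and branch sets are disjoint.
    hitsTwice-unique : ∀ {I c c′ j} → HitsTwice I c j → HitsTwice I c′ j → c ≡ c′
    hitsTwice-unique (k , k′ , ne , h , h′) (l , l′ , ne′ , g , g′) with pairs-meet k k′ l l′ ne ne′
    ... | inj₁ refl               = hits-unique h g
    ... | inj₂ (inj₁ refl)        = hits-unique h g′
    ... | inj₂ (inj₂ (inj₁ refl)) = hits-unique h′ g
    ... | inj₂ (inj₂ (inj₂ refl)) = hits-unique h′ g′

    Large : Fin copies → Fin t → Set
    Large I c = HitsCopy I c ⊎ (∃[ j ] HitsTwice I c j)

    large? : ∀ I c → Dec (Large I c)
    large? I c = any? (λ b → hits? c (inj₂ (I , b))) ⊎-dec any? (hitsTwice? I c)

    allLarge⇒≤ : ∀ {I} → (∀ c → Large I c) → t ≤ s + p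
    allLarge⇒≤ {I} large = pigeonhole (↔-id _) +↔⊎ R total unique
      where
      R : Fin t → Fin s ⊎ Fin p → Set
      R c (inj₁ b) = Hits c (inj₂ (I , b))
      R c (inj₂ j) = HitsTwice I c j
      total : ∀ c → ∃[ y ] R c y
      total c with large c
      ... | inj₁ (b , h) = inj₁ b , h
      ... | inj₂ (j , h) = inj₂ j , h
      unique : ∀ {c c′ y} → R c y → R c′ y → c ≡ c′
      unique {y = inj₁ b} = hits-unique
      unique {y = inj₂ j} = hitsTwice-unique

    transversal : ∀ {I c} → ¬ (∃[ j ] HitsTwice I c j) →
                  ∃[ f ] (∀ j k → Hits c (inj₁ (w I j k)) → f j ≡ k)
    transversal {I} {c} ¬twice = f , f-correct
      where
      f : Fin p → Fin 3
      f j with any? (λ k → hits? c (inj₁ (w I j k)))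
      ... | yes (k , _) = k
      -- Any value will do: the branch set has no window vertex in this part.
      ... | no _        = zero
      f-correct : ∀ j k → Hits c (inj₁ (w I j k)) → f j ≡ k
      f-correct j k h with any? (λ k → hits? c (inj₁ (w I j k)))
      ... | yes (k′ , h′) = decidable-stable (k′ ≟ k) λ ne → ¬twice (j , k′ , k , ne , h′ , h)
      ... | no ¬h         = ⊥-elim (¬h (k , h))

    -- A vertex b of type f has no neighbour in the branch set c₁, so every
    -- branch set must leave the set of vertices of that type.
    notLarge⇒≤ : ∀ {μ I c₀ c₁} → HitsCopy I c₀ → ¬ HitsWindow I c₀ → ¬ Large I c₁ →
                 (∀ f → HasAtLeast μ (λ b → ∀ j → τ b j ≡ f j)) → t + μ ≤ s + p * 3
    notLarge⇒≤ {μ} {I} {c₀} {c₁} copy ¬window ¬large types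
      with transversal {I} {c₁} (¬large ∘ inj₂)
    ... | f , f-correct with types f
    ...   | ι , ι-type = pigeonhole +↔⊎ ((↔-id _ ⊎-↔ *↔×) ↔-∘ +↔⊎) R total unique
      where
      OfType : Fin s → Set
      OfType b = ∀ j → τ b j ≡ f j
      R : Fin t ⊎ Fin μ → Fin s ⊎ (Fin p × Fin 3) → Set
      R (inj₁ c) (inj₁ b)       = Hits c (inj₂ (I , b)) × ¬ OfType b
      R (inj₁ c) (inj₂ (j , k)) = Hits c (inj₁ (w I j k))
      -- The `μ` vertices of type `f` occupy themselves, so no branch set may be charged to them.
      R (inj₂ x) y              = y ≡ inj₁ (Injection.to ι x)
      window? : ∀ c → Dec (HitsWindow I c)
      window? c = any? λ j → any? λ k → hits? c (inj₁ (w I j k))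
      escape : ∀ c → ∃[ y ] R (inj₁ c) y
      escape c with window? c
      ... | yes (j , k , h) = inj₂ (j , k) , h
      ... | no ¬win with meets copy ¬window c
      ...   | inj₂ win  = ⊥-elim (¬win win)
      ...   | inj₁ copy′ with adjacent {c} {c₁} (λ { refl → ¬large (inj₁ copy′) })
      ...     | x , y , πx≡ , πy≡ , e with confined copy′ ¬win πx≡
      ...       | b , ρx≡ with copy-neighbour e ρx≡
      ...         | inj₁ (b′ , ρy≡) = ⊥-elim (¬large (inj₁ (b′ , y , πy≡ , ρy≡)))
      ...         | inj₂ (j , k , ρy≡ , ne) =
        -- The edge towards `c₁` ends in a window vertex `(j , k)` with `f j ≡ k`, which a vertex of
        -- type `f` would not see through that position.
        inj₁ b , (x , πx≡ , ρx≡) , λ ofType → ne (trans (ofType j) (f-correct j k (y , πy≡ , ρy≡)))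
      total : ∀ x → ∃[ y ] R x y
      total (inj₁ c) = escape c
      total (inj₂ x) = _ , refl
      unique : ∀ {x x′ y} → R x y → R x′ y → x ≡ x′
      unique {inj₁ c} {inj₁ c′} {inj₁ b} (h , _)  (h′ , _)  = cong inj₁ (hits-unique h h′)
      unique {inj₁ c} {inj₁ c′} {inj₂ _} h        h′        = cong inj₁ (hits-unique h h′)
      unique {inj₁ c} {inj₂ x}           (_ , ne) refl      = ⊥-elim (ne (ι-type x))
      unique {inj₂ x} {inj₁ c}           refl     (_ , ne)  = ⊥-elim (ne (ι-type x))
      unique {inj₂ x} {inj₂ x′}          refl     eq        = cong inj₂ (Injection.injective ι (inj₁-injective eq))

  minorFree : ∀ {t μ} → (∀ f → HasAtLeast μ (λ b → ∀ j → τ b j ≡ f j)) →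
              n < t → s + p < t → s + p * 3 < t + μ → K t MinorFree graph
  minorFree {t} types n<t s+p<t s+3p<t+μ (H , H⊆G , contractions)
    with contractions⇒model contractions
  ... | model with confining H⊆G model n<t
  ...   | I , c₀ , copy , ¬window with all? (large? H⊆G model I)
  ...     | yes large = <⇒≱ s+p<t (allLarge⇒≤ H⊆G model large)
  ...     | no ¬large with ¬∀⟶∃¬ t _ (large? H⊆G model I) ¬large
  ...       | c₁ , ¬large₁ = <⇒≱ s+3p<t+μ (notLarge⇒≤ H⊆G model copy ¬window ¬large₁ types)

-- The list assignment and its uncolourability.

onePart : ∀ N m → Fin N → Fin (length (replicate N 1 ++ replicate m 3))
onePart (suc N) m zero    = zero
onePart (suc N) m (suc u) = suc (onePart N m u)

threePart : ∀ N m → Fin m → Fin (length (replicate N 1 ++ replicate m 3))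
threePart zero    (suc m) zero    = zero
threePart zero    (suc m) (suc c) = suc (threePart zero m c)
threePart (suc N) m       c       = suc (threePart N m c)

-- The size is a second index, so that matching on the view also evaluates the `lookup` in the field
-- `large`.
data PartView (N m : ℕ) : Fin (length (replicate N 1 ++ replicate m 3)) → ℕ → Set where
  one   : ∀ u → PartView N m (onePart N m u) 1
  three : ∀ c → PartView N m (threePart N m c) 3

partView : ∀ N m i → PartView N m i (lookup (replicate N 1 ++ replicate m 3) i)
partView zero    (suc m) zero    = three zero
partView zero    (suc m) (suc i) with lookup (replicate m 3) i | partView zero m i
... | _ | three c = three (suc c)
partView (suc N) m       zero    = one zero
partView (suc N) m       (suc i) with lookup (replicate N 1 ++ replicate m 3) i | partView N m i
... | _ | one u   = one (suc u)
... | _ | three c = three c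

-- Each part of size 3 has a fourth colour fromℕ 3; every list omits exactly
-- one of the four.
module Lists (N m : ℕ) (G : Graph) (omitted : Vertex G → Fin m → Fin 4) where

  Colour : Set
  Colour = Fin N ⊎ (Fin m × Fin 4)

  _≟C_ : (x y : Colour) → Dec (x ≡ y)
  _≟C_ = ⊎-≡-dec _≟_ (×-≡-dec _≟_ _≟_)

  L : ListAssignment G Colour
  L x (inj₁ u)       = ⊤
  L x (inj₂ (c , k)) = k ≢ omitted x c

  partOf : Colour → Fin (length (replicate N 1 ++ replicate m 3))
  partOf (inj₁ u)       = onePart N m u
  partOf (inj₂ (c , _)) = threePart N m c

  isListAssignment : IsListAssignmentOfType (replicate N 1 ++ replicate m 3) G L
  isListAssignment = record
    -- Restricted to colours that occur in some list, as `covers` asks for equality of the two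
    -- unions.
    { part     = λ i c → partOf c ≡ i × (∃[ x ] L x c)
    ; covers   = (λ {c} c∈L → partOf c , refl , c∈L) , λ (_ , _ , c∈L) → c∈L
    ; disjoint = λ (p , _) (q , _) → trans (sym p) q
    ; large    = λ i x → large x (partView N m i)
    }
    where
    large : ∀ x {i k} → PartView N m i k →
            HasAtLeast k (λ c → L x c × partOf c ≡ i × (∃[ x ] L x c))
    large x (one u) = mk↣ {to = λ _ → inj₁ u} (λ { {zero} {zero} _ → refl }) ,
                      λ _ → tt , refl , x , tt
    large x (three c) =
      mk↣ {to = λ k → inj₂ (c , punchIn (omitted x c) k)}
          (λ eq → punchIn-injective (omitted x c) _ _ (cong proj₂ (inj₂-injective eq))) ,
      λ k → punchInᵢ≢i (omitted x c) k , refl , x , punchInᵢ≢i (omitted x c) k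

module Uncolourable (n s p copies N m : ℕ)
  (τ : Fin s → Fin p → Fin 3)
  (w : Fin copies → Fin p → Fin 3 → Fin n)
  (J : Fin copies → Fin p → Fin m)
  (complete : (J₀ : Fin p → Fin m) (w₀ : Fin p → Fin 3 → Fin n) →
              ∃[ I ] ((∀ j → J I j ≡ J₀ j) × (∀ j k → w I j k ≡ w₀ j k)))
  (p+p≤1+m : p + p ≤ suc m)
  (hub-large : N + m * 3 < n + p)
  (copy-large : N + (m * 3 + p) < s + p * 3) where

  open Construction n s p copies τ w

  omittedV : V → Fin m → Fin 4
  omittedV (inj₁ q)       c = fromℕ 3
  omittedV (inj₂ (I , b)) c with any? (λ j → J I j ≟ c)
  ... | yes (j , _) = inject₁ (τ b j)
  ... | no _        = fromℕ 3

  -- Injectivity ensures that the search inside `omittedV` returns `j` itself and not another index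
  -- of the same part.
  omittedV-J : ∀ {I} → Injective _≡_ _≡_ (J I) → ∀ b j → omittedV (inj₂ (I , b)) (J I j) ≡ inject₁ (τ b j)
  omittedV-J {I} J-injective b j with any? (λ j′ → J I j′ ≟ J I j)
  ... | yes (j′ , eq) = cong (inject₁ ∘ τ b) (J-injective eq)
  ... | no ¬j         = ⊥-elim (¬j (j , refl))

  omittedV-top : ∀ I b c → fromℕ 3 ≢ omittedV (inj₂ (I , b)) c → ∃[ j ] J I j ≡ c
  omittedV-top I b c ne with any? (λ j → J I j ≟ c)
  ... | yes found = found
  ... | no _      = ⊥-elim (ne refl)

  open Lists N m graph (omittedV ∘ decode)

  module _ (colouring : Colouring graph L) where
    open Colouring colouring

    φ : V → Colour
    φ v = colour (encode v)

    φ-proper : ∀ u v → E u v → φ u ≢ φ v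
    φ-proper u v e = proper (subst (λ u → E u (decode (encode v))) (sym (decode-encode u))
                            (subst (E u) (sym (decode-encode v)) e))

    φ-list : ∀ v {c k} → φ v ≡ inj₂ (c , k) → k ≢ omittedV v c
    φ-list v {c} {k} eq = subst (λ u → k ≢ omittedV u c) (decode-encode v)
                                (subst (L (encode v)) eq (inList (encode v)))

    hub-injective : ∀ {q q′} → φ (inj₁ q) ≡ φ (inj₁ q′) → q ≡ q′
    hub-injective {q} {q′} eq = decidable-stable (q ≟ q′) λ ne → φ-proper (inj₁ q) (inj₁ q′) ne eq

    copy-injective : ∀ {I b b′} → φ (inj₂ (I , b)) ≡ φ (inj₂ (I , b′)) → b ≡ b′
    copy-injective {I} {b} {b′} eq =
      decidable-stable (b ≟ b′) λ ne → φ-proper (inj₂ (I , b)) (inj₂ (I , b′)) (refl , ne) eq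

    UsedInHub : Fin m → Fin 3 → Set
    UsedInHub c k = ∃[ q ] φ (inj₁ q) ≡ inj₂ (c , inject₁ k)

    used? : ∀ c k → Dec (UsedInHub c k)
    used? c k = any? λ q → φ (inj₁ q) ≟C inj₂ (c , inject₁ k)

    Full : Fin m → Set
    Full c = ∀ k → UsedInHub c k

    basic : Fin N ⊎ (Fin m × Fin 3) → Colour
    basic (inj₁ u)       = inj₁ u
    basic (inj₂ (c , k)) = inj₂ (c , inject₁ k)

    hub-basic : ∀ q → ∃[ y ] φ (inj₁ q) ≡ basic y
    hub-basic q with φ (inj₁ q) in eq
    ... | inj₁ u = inj₁ u , refl
    ... | inj₂ (c , k) with view k
    ...   | ‵fromℕ      = ⊥-elim (φ-list (inj₁ q) eq refl)
    ...   | ‵inject₁ k′ = inj₂ (c , k′) , refl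

    ¬manyNotFull : ¬ HasAtLeast p (U.∁ Full)
    ¬manyNotFull (e , notFull) =
      <⇒≱ hub-large (pigeonhole +↔⊎ ((↔-id _ ⊎-↔ *↔×) ↔-∘ +↔⊎) R total unique)
      where
      unused : ∀ i → ∃[ k ] ¬ UsedInHub (Injection.to e i) k
      unused i = ¬∀⟶∃¬ 3 _ (used? (Injection.to e i)) (notFull i)
      R : Fin n ⊎ Fin p → Fin N ⊎ (Fin m × Fin 3) → Set
      R (inj₁ q) y = φ (inj₁ q) ≡ basic y
      R (inj₂ i) y = y ≡ inj₂ (Injection.to e i , proj₁ (unused i))
      total : ∀ x → ∃[ y ] R x y
      total (inj₁ q) = hub-basic q
      total (inj₂ i) = _ , refl
      unique : ∀ {x x′ y} → R x y → R x′ y → x ≡ x′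
      unique {inj₁ q} {inj₁ q′} h    h′   = cong inj₁ (hub-injective (trans h (sym h′)))
      unique {inj₁ q} {inj₂ i}  h    refl = ⊥-elim (proj₂ (unused i) (q , h))
      unique {inj₂ i} {inj₁ q}  refl h    = ⊥-elim (proj₂ (unused i) (q , h))
      unique {inj₂ i} {inj₂ i′} refl h    =
        cong inj₂ (Injection.injective e (cong proj₁ (inj₂-injective h)))

    module _ (I : Fin copies) (J-injective : Injective _≡_ _≡_ (J I))
             (window : ∀ j k → φ (inj₁ (w I j k)) ≡ inj₂ (J I j , inject₁ k)) where

      -- Either `k` is the colour traded away by `b`, or `b` is adjacent to the window vertex that
      -- carries it.
      copy-avoids : ∀ b j k → φ (inj₂ (I , b)) ≢ inj₂ (J I j , inject₁ k)
      copy-avoids b j k eq with τ b j ≟ k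
      ... | yes refl = φ-list (inj₂ (I , b)) eq (sym (omittedV-J J-injective b j))
      ... | no ne    = φ-proper (inj₂ (I , b)) (inj₁ (w I j k)) (j , k , refl , ne) (trans eq (sym (window j k)))

      available : Fin N ⊎ ((Fin m × Fin 3) ⊎ Fin p) → Colour
      available (inj₁ u)              = inj₁ u
      available (inj₂ (inj₁ (c , k))) = inj₂ (c , inject₁ k)
      available (inj₂ (inj₂ j))       = inj₂ (J I j , fromℕ 3)

      copy-available : ∀ b → ∃[ y ] φ (inj₂ (I , b)) ≡ available y
      copy-available b with φ (inj₂ (I , b)) in eq
      ... | inj₁ u = inj₁ u , refl
      ... | inj₂ (c , k) with view k
      ...   | ‵inject₁ k′ = inj₂ (inj₁ (c , k′)) , refl
      ...   | ‵fromℕ with omittedV-top I b c (φ-list (inj₂ (I , b)) eq)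
      ...     | j , refl = inj₂ (inj₂ j) , refl

      -- The `s` colours on the copy and the `p * 3` window colours are distinct and all lie among
      -- the basic colours and the `p` fourth colours of the chosen parts.
      copyTooLarge : s + p * 3 ≤ N + (m * 3 + p)
      copyTooLarge = pigeonhole ((↔-id _ ⊎-↔ *↔×) ↔-∘ +↔⊎)
        ((↔-id _ ⊎-↔ ((*↔× ⊎-↔ ↔-id _) ↔-∘ +↔⊎)) ↔-∘ +↔⊎) R total unique
        where
        R : Fin s ⊎ (Fin p × Fin 3) → Fin N ⊎ ((Fin m × Fin 3) ⊎ Fin p) → Set
        R (inj₁ b)       y = φ (inj₂ (I , b)) ≡ available y
        R (inj₂ (j , k)) y = y ≡ inj₂ (inj₁ (J I j , k))
        total : ∀ x → ∃[ y ] R x y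
        total (inj₁ b) = copy-available b
        total (inj₂ _) = _ , refl
        unique : ∀ {x x′ y} → R x y → R x′ y → x ≡ x′
        unique {inj₁ b}       {inj₁ b′}        h    h′   = cong inj₁ (copy-injective (trans h (sym h′)))
        unique {inj₁ b}       {inj₂ (j , k)}   h    refl = ⊥-elim (copy-avoids b j k h)
        unique {inj₂ (j , k)} {inj₁ b}         refl h    = ⊥-elim (copy-avoids b j k h)
        unique {inj₂ (j , k)} {inj₂ (j′ , k′)} refl h with inj₁-injective (inj₂-injective h)
        ... | eq with J-injective (cong proj₁ eq) | cong proj₂ eq
        ...   | refl | refl = refl

    ¬manyFull : ¬ HasAtLeast p Full
    ¬manyFull (e , full) with complete (Injection.to e) (λ j k → proj₁ (full j k))
    ... | I , J≡ , w≡ = <⇒≱ copy-large (copyTooLarge I J-injective window)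
      where
      J-injective : Injective _≡_ _≡_ (J I)
      J-injective {j} {j′} eq = Injection.injective e (trans (sym (J≡ j)) (trans eq (J≡ j′)))
      window : ∀ j k → φ (inj₁ (w I j k)) ≡ inj₂ (J I j , inject₁ k)
      window j k rewrite J≡ j | w≡ j k = proj₂ (full j k)

  notChoosable : ¬ ((replicate N 1 ++ replicate m 3) Choosable graph)
  notChoosable choosable with choosable L isListAssignment
  -- Of the `m` parts, `p` are full or `p` are not; either case contradicts a count.
  ... | colouring with dichotomy m p p (Full colouring) (λ c → all? (used? colouring c)) p+p≤1+m
  ...   | inj₁ full    = ¬manyFull colouring full
  ...   | inj₂ notFull = ¬manyNotFull colouring notFull

-- Realising all types and windows, and the choice of parameters.

module Types (p μ e : ℕ) where

  -- The first block runs through each type `μ` times; the `e` surplus vertices pad the clique to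
  -- size `s` and get the constant type `zero`.
  τ : Fin (3 ^ p * μ + e) → Fin p → Fin 3
  τ b = [ (λ x → finToFun (proj₁ (remQuot μ x))) , (λ _ _ → zero) ]′ (splitAt (3 ^ p * μ) b)

  allTypes : ∀ f → HasAtLeast μ (λ b → ∀ j → τ b j ≡ f j)
  allTypes f = mk↣ {to = ι} (λ {x} {y} eq →
      combine-injectiveʳ (funToFin f) x (funToFin f) y (↑ˡ-injective e _ _ eq)) , ι-type
    where
    ι : Fin μ → Fin (3 ^ p * μ + e)
    ι x = combine (funToFin f) x ↑ˡ e
    ι-type : ∀ x j → τ (ι x) j ≡ f j
    ι-type x j rewrite splitAt-↑ˡ (3 ^ p * μ) (combine (funToFin f) x) e =
      trans (cong (λ y → finToFun (proj₁ y) j) (remQuot-combine (funToFin f) x)) (finToFun-funToFin f j)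

module Windows (n p m : ℕ) where

  -- Indices encode pairs of arbitrary functions, one choosing parts and one choosing window
  -- vertices, non-injective ones included.
  copies : ℕ
  copies = m ^ p * n ^ (p * 3)

  J : Fin copies → Fin p → Fin m
  J I = finToFun (proj₁ (remQuot (n ^ (p * 3)) I))

  w : Fin copies → Fin p → Fin 3 → Fin n
  w I j k = finToFun (proj₂ (remQuot {m ^ p} (n ^ (p * 3)) I)) (combine j k)

  complete : (J₀ : Fin p → Fin m) (w₀ : Fin p → Fin 3 → Fin n) →
             ∃[ I ] ((∀ j → J I j ≡ J₀ j) × (∀ j k → w I j k ≡ w₀ j k))
  complete J₀ w₀ = I , J≡ , w≡
    where
    w₁ : Fin (p * 3) → Fin n
    w₁ x = w₀ (proj₁ (remQuot {p} 3 x)) (proj₂ (remQuot {p} 3 x))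
    I : Fin copies
    I = combine (funToFin J₀) (funToFin w₁)
    J≡ : ∀ j → J I j ≡ J₀ j
    J≡ j = trans (cong (λ y → finToFun (proj₁ y) j) (remQuot-combine (funToFin J₀) (funToFin w₁)))
                 (finToFun-funToFin J₀ j)
    w≡ : ∀ j k → w I j k ≡ w₀ j k
    w≡ j k =
      trans (cong (λ y → finToFun (proj₂ y) (combine j k)) (remQuot-combine (funToFin J₀) (funToFin w₁)))
      (trans (finToFun-funToFin w₁ (combine j k))
             (cong (λ y → w₀ (proj₁ y) (proj₂ y)) (remQuot-combine j k)))

theorem3 : (a : ℕ) → ∃[ t₂ ] ((t : ℕ) → t₂ ≤ t →
    Σ[ G ∈ Graph ] (K t MinorFree G ×
    ¬ ((replicate (t ∸ 5 * a ∸ 9) 1 ++ replicate (2 * a + 3) 3) Choosable G)))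
theorem3 a = 5 * a + 9 + r , λ t t₂≤t → construct t (m≤n⇒∃[o]m+o≡n t₂≤t)
  where
  p m r : ℕ
  p = 2 + a
  m = 2 * a + 3
  -- The number of clique vertices needed for every type to occur `2 * p` times.
  r = 3 ^ p * (2 * p)
  construct : ∀ t → ∃[ d ] 5 * a + 9 + r + d ≡ t →
    Σ[ G ∈ Graph ] (K t MinorFree G × ¬ ((replicate (t ∸ 5 * a ∸ 9) 1 ++ replicate m 3) Choosable G))
  construct t (d , refl) =
    C.graph , C.minorFree T.allTypes
      -- With `t` written as `5 * a + 9 + r + d`, all required inequalities are tight: `n + 1` and
      -- `s + p + 1` equal `t`, and `s + p * 3 + 1` equals `t + 2 * p`.
      (≤-reflexive (solve 3 (λ a r d → con 1 :+ (con 5 :* a :+ con 8 :+ r :+ d) := con 5 :* a :+ con 9 :+ r :+ d) refl a r d))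
      (≤-reflexive (solve 3 (λ a r d → con 1 :+ (r :+ (con 4 :* a :+ con 6 :+ d) :+ (con 2 :+ a)) := con 5 :* a :+ con 9 :+ r :+ d) refl a r d))
      (≤-reflexive (solve 3 (λ a r d → con 1 :+ (r :+ (con 4 :* a :+ con 6 :+ d) :+ (con 2 :+ a) :* con 3) := con 5 :* a :+ con 9 :+ r :+ d :+ con 2 :* (con 2 :+ a)) refl a r d)) ,
    subst (λ N → ¬ ((replicate N 1 ++ replicate m 3) Choosable C.graph)) N≡
      (Uncolourable.notChoosable n s p W.copies (r + d) m T.τ W.w W.J W.complete
        (≤-reflexive (solve 1 (λ a → con 2 :+ a :+ (con 2 :+ a) := con 1 :+ (con 2 :* a :+ con 3)) refl a))
        (≤-reflexive (solve 3 (λ a r d → con 1 :+ (r :+ d :+ (con 2 :* a :+ con 3) :* con 3) := con 5 :* a :+ con 8 :+ r :+ d :+ (con 2 :+ a)) refl a r d))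
        (≤-reflexive (solve 3 (λ a r d → con 1 :+ (r :+ d :+ ((con 2 :* a :+ con 3) :* con 3 :+ (con 2 :+ a))) := r :+ (con 4 :* a :+ con 6 :+ d) :+ (con 2 :+ a) :* con 3) refl a r d)))
    where
    open +-*-Solver
    n s : ℕ
    n = 5 * a + 8 + r + d
    s = r + (4 * a + 6 + d)
    module T = Types p (2 * p) (4 * a + 6 + d)
    module W = Windows n p m
    module C = Construction n s p W.copies T.τ W.w
    N≡ : r + d ≡ 5 * a + 9 + r + d ∸ 5 * a ∸ 9
    N≡ = sym (trans (∸-+-assoc (5 * a + 9 + r + d) (5 * a) 9)
         (trans (cong (_∸ (5 * a + 9)) (solve 3 (λ a r d → con 5 :* a :+ con 9 :+ r :+ d := con 5 :* a :+ con 9 :+ (r :+ d)) refl a r d))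
                (m+n∸m≡n (5 * a + 9) (r + d))))
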